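{- Let $x,y,t,q$ be variables and $X=(x_0,x_1,x_2,\dots)$, $Y=(y_0,y_1,y_2,\dots)$ commutative alphabets. Define the formal power series $$\Phi(t;x,y,X,Y,q)=\sum_{I} t^{\mathrm{size}(I)}\,x^{\mathrm{contacts}(I)}\,y^{\mathrm{rises}(I)}\,\mathrm{ContactMon}(I,X)\,\mathrm{RiseMon}(I,Y)\,q^{\mathrm{dist}(I)},$$ where the sum runs over all intervals $I$ of the Tamari lattices (of all sizes). Then $$\Phi(t;x,y,X,Y,q)=\Phi(t;y,x,Y,X,q),$$ where the right-hand side is obtained by exchanging $x\leftrightarrow y$ and $x_i\leftrightarrow y_i$ for all $i$.
   Context: A Dyck path of size $n$ is a word in $\{1,0\}$ ($1$ = up-step, $0$ = down-step) with $n$ letters of each kind, every prefix having at least as many $1$'s as $0$'s; geometrically a lattice path from $(0,0)$ to $(2n,0)$ staying weakly above $y=0$. The map $\mathrm{tree}$ from Dyck paths to binary trees is: $\mathrm{tree}(\text{empty})=\emptyset$, and writing a nonempty path uniquely as $D=D_1\,1\,D_2\,0$ with $D_1,D_2$ Dyck paths, $\mathrm{tree}(D)$ has left subtree $\mathrm{tree}(D_1)$ and right subtree $\mathrm{tree}(D_2)$. The Tamari order on binary trees of size $n$ is the reflexive-transitive closure of the right rotation replacing a subtree $y(x(A,B),C)$ by $x(A,y(B,C))$ (the result is larger); it is transported to Dyck paths via $\mathrm{tree}$. A Tamari interval of size $n$ is a pair $[D_1,D_2]$ of Dyck paths of size $n$ with $D_1\le D_2$; $\mathrm{size}(I)=n$.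 Statistics of a Dyck path $D$ of size $n$: $\mathrm{contacts}(D)$ is the number of points of the path at height $0$ other than the final point; $\mathrm{rises}(D)$ is the number of initial consecutive up-steps; for $1\le i\le n$, $\mathrm{contacts}_i(D)$ is the number of non-final contacts (points at its base height other than its last point) of the maximal Dyck subpath starting right after the $i$-th up-step (i.e. the part strictly between the $i$-th up-step and its matching down-step); $\mathrm{rises}_i(D)$ is the number of consecutive up-steps immediately following the $i$-th down-step. The contact monomial is $\mathrm{ContactMon}(D,X)=x_{\mathrm{contacts}(D)}\prod_{i=1}^{n-1}x_{\mathrm{contacts}_i(D)}$ and the rise monomial is $\mathrm{RiseMon}(D,Y)=y_{\mathrm{rises}(D)}\prod_{i=1}^{n-1}y_{\mathrm{rises}_i(D)}$. For a Tamari interval $I=[D_1,D_2]$: $\mathrm{contacts}(I)=\mathrm{contacts}(D_1)$, $\mathrm{ContactMon}(I,X)=\mathrm{ContactMon}(D_1,X)$ (lower bound), $\mathrm{rises}(I)=\mathrm{rises}(D_2)$, $\mathrm{RiseMon}(I,Y)=\mathrm{RiseMon}(D_2,Y)$ (upper bound). The distance $\mathrm{dist}(I)$ is the maximal length $k-1$ of a chain $D_1=P_1<P_2<\dots<P_k=D_2$ in the Tamari lattice. -}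

module Defs where

open import Data.Bool using (Bool; true; false; if_then_else_)
open import Data.Nat using (ℕ; zero; suc; _+_; _*_; _∸_; _≤_)
open import Data.Integer as ℤ using (ℤ; +_; -[1+_]; _<?_)
open import Data.List using (List; []; _∷_; length; take; drop; filter; upTo; map; foldr)
open import Data.List.Relation.Binary.Permutation.Propositional using (_↭_)
open import Data.Product using (_×_; Σ; ∃)
open import Relation.Binary.PropositionalEquality using (_≡_; _≢_)
open import Relation.Binary.Construct.Closure.ReflexiveTransitive using (Star)
open import Relation.Nullary using (¬_)

-- Dyck paths: words over Bool, true = up-step (1), false = down-step (0)

step : Bool → ℤ
step true  = + 1
step false = -[1+ 0 ]

height : List Bool → ℤ
height []      = + 0
height (b ∷ w) = step b ℤ.+ height w

IsDyck : ℕ → List Bool → Set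
IsDyck n w = (length w ≡ 2 * n) × (height w ≡ + 0) ×
             (∀ i → i ≤ length w → ℤ.+ 0 ℤ.≤ height (take i w))

contacts : List Bool → ℕ
contacts D = length (filter (λ i → height (take i D) ℤ.≟ + 0) (upTo (length D)))

afterUp : ℕ → List Bool → List Bool
afterUp _ []                  = []
afterUp zero w                = w
afterUp (suc zero) (true ∷ w) = w
afterUp (suc (suc i)) (true ∷ w) = afterUp (suc i) w
afterUp (suc i) (false ∷ w)   = afterUp (suc i) w

afterDown : ℕ → List Bool → List Bool
afterDown _ []                  = []
afterDown zero w                = w
afterDown (suc zero) (false ∷ w) = w
afterDown (suc (suc i)) (false ∷ w) = afterDown (suc i) w
afterDown (suc i) (true ∷ w)    = afterDown (suc i) w

-- maximal prefix never going below the starting height: applied right after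
-- an up-step, this is the part strictly before the matching down-step
maxDyckPrefix : List Bool → List Bool
maxDyckPrefix = go (+ 0)
  where
  go : ℤ → List Bool → List Bool
  go h []      = []
  go h (b ∷ w) with (h ℤ.+ step b) <? + 0
  ... | Relation.Nullary.yes _ = []
  ... | Relation.Nullary.no  _ = b ∷ go (h ℤ.+ step b) w

leadingUps : List Bool → ℕ
leadingUps (true ∷ w) = suc (leadingUps w)
leadingUps _          = 0

rises : List Bool → ℕ
rises = leadingUps

contactsᵢ : ℕ → List Bool → ℕ
contactsᵢ i D = contacts (maxDyckPrefix (afterUp i D))

risesᵢ : ℕ → List Bool → ℕ
risesᵢ i D = leadingUps (afterDown i D)

oneTo : ℕ → List ℕ
oneTo n = map suc (upTo (n ∸ 1))

-- monomials in a commutative alphabet are represented by the multiset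
-- (list up to permutation) of the indices of their letters:
-- ContactMon(D,X) = x_{contacts D} ∏_{i=1}^{n-1} x_{contacts_i D}
contactMon : ℕ → List Bool → List ℕ
contactMon n D = contacts D ∷ map (λ i → contactsᵢ i D) (oneTo n)

riseMon : ℕ → List Bool → List ℕ
riseMon n D = rises D ∷ map (λ i → risesᵢ i D) (oneTo n)

data Tree : Set where
  leaf : Tree
  node : Tree → Tree → Tree

lastZero : List Bool → ℕ
lastZero w = foldr (λ j acc → if isZero (height (take j w)) then j else acc) 0
                   (reverse' (upTo (length w)))
  where
  isZero : ℤ → Bool
  isZero (+ 0) = true
  isZero _     = false
  reverse' : List ℕ → List ℕ
  reverse' = foldr (λ x acc → acc Data.List.++ (x ∷ [])) []

-- D = D₁ 1 D₂ 0 : tree D = node (tree D₁) (tree D₂); the fuel argument is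
-- only for termination (length D is always sufficient)
treeF : ℕ → List Bool → Tree
treeF zero    _  = leaf
treeF (suc f) [] = leaf
treeF (suc f) D@(_ ∷ _) =
  node (treeF f (take j D)) (treeF f (take (length D ∸ j ∸ 2) (drop (suc j) D)))
  where j = lastZero D

tree : List Bool → Tree
tree D = treeF (length D) D

data Rot : Tree → Tree → Set where
  rot   : ∀ {A B C} → Rot (node (node A B) C) (node A (node B C))
  left  : ∀ {l l′ r} → Rot l l′ → Rot (node l r) (node l′ r)
  right : ∀ {l r r′} → Rot r r′ → Rot (node l r) (node l r′)

_≤T_ : Tree → Tree → Set
_≤T_ = Star Rot

_<T_ : Tree → Tree → Set
s <T t = (s ≤T t) × (s ≢ t)

_≤D_ : List Bool → List Bool → Set
D ≤D D′ = tree D ≤T tree D′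

data Chain : Tree → Tree → ℕ → Set where
  [] : ∀ {t} → Chain t t 0
  _∷_ : ∀ {s t u k} → s <T t → Chain t u k → Chain s u (suc k)

Dist : List Bool → List Bool → ℕ → Set
Dist D₁ D₂ d = Chain (tree D₁) (tree D₂) d ×
               (∀ k → Chain (tree D₁) (tree D₂) k → k ≤ d)

-- Coefficient of t^n x^a y^b X^M Y^N q^d in Φ(t;x,y,X,Y,q):
-- the set of Tamari intervals [D₁,D₂] of size n with contacts(D₁) = a,
-- rises(D₂) = b, ContactMon(D₁) = X^M, RiseMon(D₂) = Y^N, dist = d.
-- All proof fields are irrelevant, so elements are determined by (D₁,D₂)
-- and the cardinality of this set is exactly the coefficient.

record Coef (n a b : ℕ) (M N : List ℕ) (d : ℕ) : Set where
  field
    lower upper : List Bool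
    .lowerDyck  : IsDyck n lower
    .upperDyck  : IsDyck n upper
    .interval   : lower ≤D upper
    .contactsEq : contacts lower ≡ a
    .risesEq    : rises upper ≡ b
    .cmonEq     : contactMon n lower ↭ M
    .rmonEq     : riseMon n upper ↭ N
    .distEq     : Dist lower upper d

{-# OPTIONS --safe #-}

-- A Dyck path is the contour of a plane forest; contacts(D) is the number of trees and
-- contactsᵢ(D) the number of children of the i-th node in preorder.  A Tamari interval
-- [F , G] is the same thing as the forest G whose i-th node carries the child count of the
-- i-th node of F: the admissible labellings are those in which the labels of every
-- subtree of G add up to less than its size.  The length of a longest chain from F to G
-- is the sum over all subtrees of the slack in this inequality.  Reflecting the labelled
-- plane forest in a vertical line is therefore an involution (reflect) on intervals which
-- keeps the distance and the contact monomial and mirrors the upper forest.  Taking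
-- mirror images of binary trees (transpose) reverses the Tamari order and keeps
-- distances.  Since the rises of G are the lengths of the right branches of the
-- binary tree of the mirrored G, and contacts are lengths of left branches, the composite
-- reflect ∘ transpose ∘ reflect exchanges rises and contacts.
module Submission where

open import Defs
open import Data.Bool using (Bool; true; false; if_then_else_)
import Data.Bool.Properties as Bool
open import Data.Integer as ℤ using (ℤ; +_; -[1+_])
import Data.Integer.Properties as ℤ
open import Data.List using (List; []; _∷_; _++_; _∷ʳ_; length; take; drop; map; foldr; filter; reverse; upTo; downFrom; applyUpTo)
import Data.List.Properties as List
open import Data.List.Relation.Binary.Permutation.Propositional using (_↭_; ↭-refl; ↭-sym; ↭-trans; ↭-reflexive; prep)
import Data.List.Relation.Binary.Permutation.Propositional.Properties as Perm
open import Data.Nat using (ℕ; zero; suc; _+_; _*_; _∸_; _≤_; _<_; z≤n; s≤s)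
open import Data.Nat.Properties
open import Data.Product using (Σ; _×_; _,_; ∃; proj₁; proj₂)
import Data.Product.Properties as Product
open import Data.Sum using (_⊎_; inj₁; inj₂)
open import Data.Unit using (⊤; tt)
open import Function using (_∘_; id)
open import Function.Bundles using (_↔_; mk↔ₛ′)
open import Relation.Binary.Construct.Closure.ReflexiveTransitive using (_◅_; _◅◅_) renaming (ε to done)
open import Relation.Binary.PropositionalEquality hiding (J)
open import Relation.Nullary using (yes; no; does; contradiction; recompute)
open import Relation.Unary using (Decidable)

-- Plane forests and labellings

data Forest (A : Set) : Set where
  ε    : Forest A
  node : A → Forest A → Forest A → Forest A

Plane : Set
Plane = Forest ⊤

infixr 6 _▸_
infixr 5 _⊕_

pattern _▸_ c r = node tt c r

_⊕_ : ∀ {A} → Forest A → Forest A → Forest A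
ε ⊕ G = G
node a c r ⊕ G = node a c (r ⊕ G)

⊕-identityʳ : ∀ {A} (F : Forest A) → F ⊕ ε ≡ F
⊕-identityʳ ε = refl
⊕-identityʳ (node a c r) = cong (node a c) (⊕-identityʳ r)

⊕-assoc : ∀ {A} (F G H : Forest A) → (F ⊕ G) ⊕ H ≡ F ⊕ (G ⊕ H)
⊕-assoc ε G H = refl
⊕-assoc (node a c r) G H = cong (node a c) (⊕-assoc r G H)

mirror : ∀ {A} → Forest A → Forest A
mirror ε = ε
mirror (node a c r) = mirror r ⊕ node a (mirror c) ε

mirror-⊕ : ∀ {A} (F G : Forest A) → mirror (F ⊕ G) ≡ mirror G ⊕ mirror F
mirror-⊕ ε G = sym (⊕-identityʳ (mirror G))
mirror-⊕ (node a c r) G = trans (cong (_⊕ node a (mirror c) ε) (mirror-⊕ r G))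
                                (⊕-assoc (mirror G) (mirror r) _)

mirror-involutive : ∀ {A} (F : Forest A) → mirror (mirror F) ≡ F
mirror-involutive ε = refl
mirror-involutive (node a c r) =
  trans (mirror-⊕ (mirror r) (node a (mirror c) ε))
        (cong₂ (node a) (mirror-involutive c) (mirror-involutive r))

size : ∀ {A} → Forest A → ℕ
size ε = 0
size (node a c r) = suc (size c + size r)

size-⊕ : ∀ {A} (F G : Forest A) → size (F ⊕ G) ≡ size F + size G
size-⊕ ε G = refl
size-⊕ (node a c r) G =
  cong suc (trans (cong (λ k → size c + k) (size-⊕ r G)) (sym (+-assoc (size c) (size r) (size G))))

size-mirror : ∀ {A} (F : Forest A) → size (mirror F) ≡ size F
size-mirror ε = refl
size-mirror (node a c r) = begin
  size (mirror r ⊕ node a (mirror c) ε)  ≡⟨ size-⊕ (mirror r) _ ⟩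
  size (mirror r) + suc (size (mirror c) + 0)  ≡⟨ cong₂ (λ x y → x + suc y) (size-mirror r) (trans (+-identityʳ _) (size-mirror c)) ⟩
  size r + suc (size c)  ≡⟨ +-comm (size r) (suc (size c)) ⟩
  suc (size c + size r)  ∎
  where open ≡-Reasoning

len : Plane → ℕ
len ε = 0
len (_ ▸ r) = suc (len r)

len-⊕ : ∀ F G → len (F ⊕ G) ≡ len F + len G
len-⊕ ε G = refl
len-⊕ (_ ▸ r) G = cong suc (len-⊕ r G)

-- In preorder these are the numbers `contactsᵢ` of the contour word; see `afterUps-word`.
code : Plane → List ℕ
code ε = []
code (c ▸ r) = len c ∷ code c ++ code r

code-⊕ : ∀ F G → code (F ⊕ G) ≡ code F ++ code G
code-⊕ ε G = refl
code-⊕ (c ▸ r) G = cong (len c ∷_) (trans (cong (code c ++_) (code-⊕ r G))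
                                          (sym (List.++-assoc (code c) (code r) (code G))))

length-code : ∀ F → length (code F) ≡ size F
length-code ε = refl
length-code (c ▸ r) = cong suc (trans (List.length-++ (code c)) (cong₂ _+_ (length-code c) (length-code r)))

takeF dropF : ℕ → Plane → Plane
takeF zero    F       = ε
takeF (suc k) ε       = ε
takeF (suc k) (c ▸ r) = c ▸ takeF k r
dropF zero    F       = F
dropF (suc k) ε       = ε
dropF (suc k) (c ▸ r) = dropF k r

take⊕drop : ∀ k F → takeF k F ⊕ dropF k F ≡ F
take⊕drop zero    F       = refl
take⊕drop (suc k) ε       = refl
take⊕drop (suc k) (c ▸ r) = cong (c ▸_) (take⊕drop k r)

len-take : ∀ k F → k ≤ len F → len (takeF k F) ≡ k
len-take zero    F       _       = refl
len-take (suc k) (c ▸ r) (s≤s p) = cong suc (len-take k r p)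

len-drop : ∀ k F → len (dropF k F) ≡ len F ∸ k
len-drop zero    F       = refl
len-drop (suc k) ε       = refl
len-drop (suc k) (c ▸ r) = len-drop k r

take-len : ∀ F G → takeF (len F) (F ⊕ G) ≡ F
take-len ε       G = refl
take-len (c ▸ r) G = cong (c ▸_) (take-len r G)

drop-len : ∀ F G → dropF (len F) (F ⊕ G) ≡ G
drop-len ε       G = refl
drop-len (c ▸ r) G = drop-len r G

-- Labelled forests and the intervals they encode.

shape : Forest ℕ → Plane
shape ε = ε
shape (node _ c r) = shape c ▸ shape r

shape-⊕ : ∀ x y → shape (x ⊕ y) ≡ shape x ⊕ shape y
shape-⊕ ε y = refl
shape-⊕ (node _ c r) y = cong (shape c ▸_) (shape-⊕ r y)

shape-mirror : ∀ x → shape (mirror x) ≡ mirror (shape x)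
shape-mirror ε = refl
shape-mirror (node k c r) = trans (shape-⊕ (mirror r) _)
  (cong₂ (λ u v → u ⊕ (v ▸ ε)) (shape-mirror r) (shape-mirror c))

labels : Forest ℕ → List ℕ
labels ε = []
labels (node k c r) = k ∷ labels c ++ labels r

labels-⊕ : ∀ x y → labels (x ⊕ y) ≡ labels x ++ labels y
labels-⊕ ε y = refl
labels-⊕ (node k c r) y = cong (k ∷_) (trans (cong (labels c ++_) (labels-⊕ r y))
                                             (sym (List.++-assoc (labels c) (labels r) (labels y))))

labels-mirror : ∀ x → labels (mirror x) ↭ labels x
labels-mirror ε = ↭-refl
labels-mirror (node k c r) =
  ↭-trans (↭-reflexive (trans (labels-⊕ (mirror r) _) (cong (λ l → labels (mirror r) ++ k ∷ l) (List.++-identityʳ _))))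
  (↭-trans (Perm.++-comm (labels (mirror r)) (k ∷ labels (mirror c)))
           (prep k (Perm.++⁺ (labels-mirror c) (labels-mirror r))))

-- A labelled forest x encodes the interval [lower x , shape x]: the label k of a
-- node says how many trees of the forest below it stay below it in lower x, the
-- remaining ones becoming its right siblings.
lower : Forest ℕ → Plane
lower ε = ε
lower (node k c r) = takeF k (lower c) ▸ (dropF k (lower c) ⊕ lower r)

-- The number of trees of `lower x`, by `len-lower`. On valid labellings it is the size of `x` minus
-- the sum of its labels, which turns `Valid` into the condition on the label sums of subtrees.
width : Forest ℕ → ℕ
width ε = 0
width (node k c r) = suc ((width c ∸ k) + width r)

slack : Forest ℕ → ℕ
slack ε = 0
slack (node k c r) = (width c ∸ k) + (slack c + slack r)

Valid : Forest ℕ → Set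
Valid ε = ⊤
Valid (node k c r) = k ≤ width c × Valid c × Valid r

len-lower : ∀ x → len (lower x) ≡ width x
len-lower ε = refl
len-lower (node k c r) = cong suc (trans (len-⊕ (dropF k (lower c)) (lower r))
  (cong₂ _+_ (trans (len-drop k (lower c)) (cong (_∸ k) (len-lower c))) (len-lower r)))

-- Cutting `lower c` after `k` trees only turns the remaining ones into right siblings of the node.
-- Preorder and all other child counts stay the same, and the node gets exactly `k` children because
-- validity gives `k ≤ width c`.
code-lower : ∀ x → Valid x → code (lower x) ≡ labels x
code-lower ε _ = refl
code-lower (node k c r) (k≤ , vc , vr) = cong₂ _∷_
  (len-take k (lower c) (subst (k ≤_) (sym (len-lower c)) k≤))
  (begin
    code T ++ code (D ⊕ lower r)         ≡⟨ cong (code T ++_) (code-⊕ D (lower r)) ⟩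
    code T ++ (code D ++ code (lower r)) ≡⟨ List.++-assoc (code T) (code D) _ ⟨
    (code T ++ code D) ++ code (lower r) ≡⟨ cong (_++ code (lower r)) (code-⊕ T D) ⟨
    code (T ⊕ D) ++ code (lower r)       ≡⟨ cong (λ F → code F ++ code (lower r)) (take⊕drop k (lower c)) ⟩
    code (lower c) ++ code (lower r)     ≡⟨ cong₂ _++_ (code-lower c vc) (code-lower r vr) ⟩
    labels c ++ labels r                 ∎)
  where
  open ≡-Reasoning
  T = takeF k (lower c)
  D = dropF k (lower c)

width-⊕ : ∀ x y → width (x ⊕ y) ≡ width x + width y
width-⊕ ε y = refl
width-⊕ (node k c r) y = cong suc (trans (cong (λ u → (width c ∸ k) + u) (width-⊕ r y))
                                         (sym (+-assoc (width c ∸ k) (width r) (width y))))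

-- `width` and `slack` add up contributions of siblings, and addition ignores their order; for the
-- same reason validity survives the mirror.
width-mirror : ∀ x → width (mirror x) ≡ width x
width-mirror ε = refl
width-mirror (node k c r) = begin
  width (mirror r ⊕ node k (mirror c) ε)           ≡⟨ width-⊕ (mirror r) _ ⟩
  width (mirror r) + suc ((width (mirror c) ∸ k) + 0)
    ≡⟨ cong₂ (λ u v → u + suc v) (width-mirror r) (trans (+-identityʳ _) (cong (_∸ k) (width-mirror c))) ⟩
  width r + suc (width c ∸ k)                      ≡⟨ +-comm (width r) _ ⟩
  suc ((width c ∸ k) + width r)                    ∎
  where open ≡-Reasoning

slack-⊕ : ∀ x y → slack (x ⊕ y) ≡ slack x + slack y
slack-⊕ ε y = refl
slack-⊕ (node k c r) y = begin
  s + (slack c + slack (r ⊕ y))       ≡⟨ cong (λ u → s + (slack c + u)) (slack-⊕ r y) ⟩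
  s + (slack c + (slack r + slack y)) ≡⟨ cong (λ u → s + u) (+-assoc (slack c) (slack r) (slack y)) ⟨
  s + ((slack c + slack r) + slack y) ≡⟨ +-assoc s _ _ ⟨
  (s + (slack c + slack r)) + slack y ∎
  where
  open ≡-Reasoning
  s = width c ∸ k

slack-mirror : ∀ x → slack (mirror x) ≡ slack x
slack-mirror ε = refl
slack-mirror (node k c r) = begin
  slack (mirror r ⊕ node k (mirror c) ε)           ≡⟨ slack-⊕ (mirror r) _ ⟩
  slack (mirror r) + ((width (mirror c) ∸ k) + (slack (mirror c) + 0))
    ≡⟨ cong₂ _+_ (slack-mirror r) (cong₂ _+_ (cong (_∸ k) (width-mirror c)) (trans (+-identityʳ _) (slack-mirror c))) ⟩
  slack r + (s + slack c)                          ≡⟨ +-comm (slack r) _ ⟩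
  (s + slack c) + slack r                          ≡⟨ +-assoc s _ _ ⟩
  s + (slack c + slack r)                          ∎
  where
  open ≡-Reasoning
  s = width c ∸ k

valid-⊕ : ∀ x y → Valid x → Valid y → Valid (x ⊕ y)
valid-⊕ ε y _ vy = vy
valid-⊕ (node k c r) y (k≤ , vc , vr) vy = k≤ , vc , valid-⊕ r y vr vy

valid-mirror : ∀ x → Valid x → Valid (mirror x)
valid-mirror ε _ = tt
valid-mirror (node k c r) (k≤ , vc , vr) =
  valid-⊕ (mirror r) _ (valid-mirror r vr)
    (subst (k ≤_) (sym (width-mirror c)) k≤ , valid-mirror c vc , tt)

relabel : Plane → List ℕ → Forest ℕ × List ℕ
relabel ε       ks       = ε , ks
-- A default, reached only when the list is shorter than the forest.
relabel (c ▸ r) []       = ε , []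
relabel (c ▸ r) (k ∷ ks) = let (x , ks′) = relabel c ks ; (y , ks″) = relabel r ks′
                           in node k x y , ks″

relabel-labels : ∀ x ks → relabel (shape x) (labels x ++ ks) ≡ (x , ks)
relabel-labels ε ks = refl
relabel-labels (node k c r) ks
  rewrite List.++-assoc (labels c) (labels r) ks
        | relabel-labels c (labels r ++ ks)
        | relabel-labels r ks = refl

label : Plane → Plane → Forest ℕ
label F G = proj₁ (relabel G (code F))

-- By `code-lower` the child counts of `lower x` are the labels in preorder, so writing them back
-- onto the shape restores `x`.
label-lower-shape : ∀ x → Valid x → label (lower x) (shape x) ≡ x
label-lower-shape x v = cong proj₁
  (trans (cong (relabel (shape x)) (trans (code-lower x v) (sym (List.++-identityʳ _)))) (relabel-labels x []))

-- F ≼ G [ d ] : an interval of length d, where p is the part of the forest below a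
-- node of G that is not below the corresponding node of F.
data _≼_[_] : Plane → Plane → ℕ → Set where
  ε     : ε ≼ ε [ 0 ]
  graft : ∀ {c₁ r₁ c₂ r₂ d e} p {q} → r₁ ≡ p ⊕ q → (c₁ ⊕ p) ≼ c₂ [ d ] → q ≼ r₂ [ e ] →
          (c₁ ▸ r₁) ≼ (c₂ ▸ r₂) [ len p + (d + e) ]

lower≼shape : ∀ x → Valid x → lower x ≼ shape x [ slack x ]
lower≼shape ε _ = ε
lower≼shape (node k c r) (k≤ , vc , vr) =
  subst (λ s → lower (node k c r) ≼ shape (node k c r) [ s + (slack c + slack r) ])
    (trans (len-drop k (lower c)) (cong (_∸ k) (len-lower c)))
    (graft (dropF k (lower c)) refl
      (subst (_≼ shape c [ slack c ]) (sym (take⊕drop k (lower c))) (lower≼shape c vc))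
      (lower≼shape r vr))

-- Here `c₁ ⊕ p` is the lower forest of the children and `q` that of the right siblings. The node is
-- labelled by the number of trees before the cut, and `len p` is its share of the slack.
≼⇒labelling : ∀ {F G d} → F ≼ G [ d ] →
  Σ (Forest ℕ) λ x → Valid x × lower x ≡ F × shape x ≡ G × slack x ≡ d
≼⇒labelling ε = ε , tt , refl , refl , refl
≼⇒labelling (graft {c₁} {r₁} {c₂} {r₂} {d} {e} p {q} r₁≡ s t)
  with ≼⇒labelling s | ≼⇒labelling t
... | x , vx , lx , sx , dx | y , vy , ly , sy , dy =
  node (len c₁) x y
  , (subst (len c₁ ≤_) (sym wx) (m≤m+n (len c₁) (len p)) , vx , vy)
  , cong₂ _▸_ (trans (cong (takeF (len c₁)) lx) (take-len c₁ p))
      (trans (cong₂ _⊕_ (trans (cong (dropF (len c₁)) lx) (drop-len c₁ p)) ly) (sym r₁≡))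
  , cong₂ _▸_ sx sy
  , cong₂ _+_ (trans (cong (_∸ len c₁) wx) (m+n∸m≡n (len c₁) (len p))) (cong₂ _+_ dx dy)
  where
  wx : width x ≡ len c₁ + len p
  wx = trans (sym (len-lower x)) (trans (cong len lx) (len-⊕ c₁ p))

-- Every valid labelling of the interval equals `label F G`, which makes the index `d` a function of
-- `F` and `G`; the upper bound in `≼⇒DistT` rests on this.
label-≼ : ∀ {F G d} → F ≼ G [ d ] → let x = label F G in
  Valid x × lower x ≡ F × shape x ≡ G × slack x ≡ d
label-≼ s with ≼⇒labelling s
... | x , v , refl , refl , refl rewrite label-lower-shape x v = v , refl , refl , refl

-- Rotations of plane forests.

-- The rotation y(x(A,B),C) → x(A,y(B,C)) read on forests: the right sibling y of x
-- becomes its last child.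
infix 4 _↝_
data _↝_ : Plane → Plane → Set where
  merge : ∀ {c y r} → (c ▸ y ▸ r) ↝ ((c ⊕ (y ▸ ε)) ▸ r)
  inner : ∀ {c c′ r} → c ↝ c′ → (c ▸ r) ↝ (c′ ▸ r)
  outer : ∀ {c r r′} → r ↝ r′ → (c ▸ r) ↝ (c ▸ r′)

↝-⊕ʳ : ∀ {F F′} H → F ↝ F′ → (F ⊕ H) ↝ (F′ ⊕ H)
↝-⊕ʳ H merge     = merge
↝-⊕ʳ H (inner s) = inner s
↝-⊕ʳ H (outer s) = outer (↝-⊕ʳ H s)

↝-⊕ˡ : ∀ {F F′} H → F ↝ F′ → (H ⊕ F) ↝ (H ⊕ F′)
↝-⊕ˡ ε       s = s
↝-⊕ˡ (c ▸ r) s = outer (↝-⊕ˡ r s)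

-- A merge produces a single tree, which lies on one side of the cut; undoing it leaves both pieces
-- on that side.
↝-split : ∀ {F} G {H} → F ↝ (G ⊕ H) →
  (∃ λ G₀ → F ≡ G₀ ⊕ H × G₀ ↝ G) ⊎ (∃ λ H₀ → F ≡ G ⊕ H₀ × H₀ ↝ H)
↝-split ε       s = inj₂ (_ , refl , s)
↝-split (_ ▸ r) (merge {c} {y}) = inj₁ (c ▸ y ▸ r , refl , merge)
↝-split (_ ▸ r) (inner {c} s)   = inj₁ (c ▸ r , refl , inner s)
↝-split (c ▸ r) (outer s) with ↝-split r s
... | inj₁ (G₀ , refl , t) = inj₁ (c ▸ G₀ , refl , outer t)
... | inj₂ (H₀ , refl , t) = inj₂ (H₀ , refl , t)

≼-refl : ∀ F → F ≼ F [ 0 ]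
≼-refl ε = ε
≼-refl (c ▸ r) = graft ε refl (subst (_≼ c [ 0 ]) (sym (⊕-identityʳ c)) (≼-refl c)) (≼-refl r)

-- Undoing a merge at the root puts `y` in front of `p`, which adds one to the slack. Any other
-- rotation happens inside `c`, `p` or `q`, and the slack grows in the recursive call. The strict
-- growth bounds the length of chains.
↝-≼ : ∀ {F F′ G d} → F ↝ F′ → F′ ≼ G [ d ] → ∃ λ e → d < e × F ≼ G [ e ]
↝-≼ (merge {c} {y}) (graft {c₂ = c₂} {d = d} p refl s t) =
  _ , ≤-refl , graft (y ▸ p) refl (subst (_≼ c₂ [ d ]) (⊕-assoc c (y ▸ ε) p) s) t
↝-≼ (inner u) (graft {e = e} p r≡ s t) with ↝-≼ (↝-⊕ʳ p u) s
... | d′ , d<d′ , s′ = _ , +-monoʳ-< (len p) (+-monoˡ-< e d<d′) , graft p r≡ s′ t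
↝-≼ (outer {c} u) (graft {d = d} {e = e} p refl s t) with ↝-split p u
... | inj₂ (q₀ , refl , u′) with ↝-≼ u′ t
...   | e′ , e<e′ , t′ = _ , +-monoʳ-< (len p) (+-monoʳ-< d e<e′) , graft p refl s t′
-- The trees of `p` lie below the node in the upper forest, so this rotation is handled inside
-- `c ⊕ p`; going back to `p₀`, the term `len p` does not shrink.
↝-≼ (outer {c} u) (graft {d = d} {e = e} p refl s t) | inj₁ (p₀ , refl , u′) with ↝-≼ (↝-⊕ˡ c u′) s
...   | d′ , d<d′ , s′ = _ , +-mono-≤-< (len-↝ u′) (+-monoˡ-< e d<d′) , graft p₀ refl s′ t
  where
  len-↝ : ∀ {F F′} → F ↝ F′ → len F′ ≤ len F
  len-↝ merge     = n≤1+n _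
  len-↝ (inner _) = ≤-refl
  len-↝ (outer v) = s≤s (len-↝ v)

-- Plane forests and binary trees.

-- Left subtrees hold the earlier siblings, right subtrees the children.
toForest : Tree → Plane
toForest leaf       = ε
toForest (node l r) = toForest l ⊕ (toForest r ▸ ε)

-- `t` is an accumulator: each tree of the forest puts a new root on top of it, with the earlier
-- siblings as left subtree.
extend : Tree → Plane → Tree
extend t ε       = t
extend t (c ▸ r) = extend (node t (extend leaf c)) r

toTree : Plane → Tree
toTree = extend leaf

extend-⊕ : ∀ t F G → extend t (F ⊕ G) ≡ extend (extend t F) G
extend-⊕ t ε       G = refl
extend-⊕ t (c ▸ r) G = extend-⊕ (node t (toTree c)) r G

toTree-toForest : ∀ t → toTree (toForest t) ≡ t
toTree-toForest leaf = refl
toTree-toForest (node l r) = trans (extend-⊕ leaf (toForest l) _)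
  (cong₂ node (toTree-toForest l) (toTree-toForest r))

toForest-extend : ∀ t F → toForest (extend t F) ≡ toForest t ⊕ F
toForest-extend t ε = sym (⊕-identityʳ _)
toForest-extend t (c ▸ r) = begin
  toForest (extend (node t (toTree c)) r)           ≡⟨ toForest-extend (node t (toTree c)) r ⟩
  (toForest t ⊕ (toForest (toTree c) ▸ ε)) ⊕ r      ≡⟨ ⊕-assoc (toForest t) _ r ⟩
  toForest t ⊕ (toForest (toTree c) ▸ r)            ≡⟨ cong (λ F → toForest t ⊕ (F ▸ r)) (toForest-extend leaf c) ⟩
  toForest t ⊕ (c ▸ r)                              ∎
  where open ≡-Reasoning

toForest-toTree : ∀ F → toForest (toTree F) ≡ F
toForest-toTree = toForest-extend leaf

Rot⇒↝ : ∀ {s t} → Rot s t → toForest s ↝ toForest t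
Rot⇒↝ (rot {A} {B} {C}) =
  subst (_↝ toForest (node A (node B C))) (sym (⊕-assoc (toForest A) _ _)) (↝-⊕ˡ (toForest A) merge)
Rot⇒↝ (left s)            = ↝-⊕ʳ _ (Rot⇒↝ s)
Rot⇒↝ (right {l} s)       = ↝-⊕ˡ (toForest l) (inner (Rot⇒↝ s))

Rot-extend : ∀ {s t} F → Rot s t → Rot (extend s F) (extend t F)
Rot-extend ε       s = s
Rot-extend (c ▸ r) s = Rot-extend r (left s)

↝⇒Rot : ∀ {F G} t → F ↝ G → Rot (extend t F) (extend t G)
-- Before and after the merge the accumulators are `node (node t (toTree c)) (toTree y)` and
-- `node t (node (toTree c) (toTree y))`.
↝⇒Rot t (merge {c} {y} {r}) rewrite extend-⊕ leaf c (y ▸ ε) = Rot-extend r rot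
↝⇒Rot t (inner {r = r} s)   = Rot-extend r (right (↝⇒Rot leaf s))
↝⇒Rot t (outer {c} s)       = ↝⇒Rot (node t (toTree c)) s

-- Chains of rotations and their maximal length.

data Steps : Plane → Plane → ℕ → Set where
  []  : ∀ {F} → Steps F F 0
  _∷_ : ∀ {F G H k} → F ↝ G → Steps G H k → Steps F H (suc k)

Steps-trans : ∀ {F G H j k} → Steps F G j → Steps G H k → Steps F H (j + k)
Steps-trans []       v = v
Steps-trans (s ∷ u) v = s ∷ Steps-trans u v

Steps-map : ∀ {F G k} (f : Plane → Plane) → (∀ {F G} → F ↝ G → f F ↝ f G) → Steps F G k → Steps (f F) (f G) k
Steps-map f g []      = []
Steps-map f g (s ∷ u) = g s ∷ Steps-map f g u

-- Each tree of `p` costs one merge; taking them from left to right keeps their order behind the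
-- children `c`.
absorb : ∀ c p q → Steps (c ▸ (p ⊕ q)) ((c ⊕ p) ▸ q) (len p)
absorb c ε       q rewrite ⊕-identityʳ c = []
absorb c (y ▸ p) q = merge ∷ subst (λ F → Steps ((c ⊕ (y ▸ ε)) ▸ (p ⊕ q)) (F ▸ q) (len p))
                                   (⊕-assoc c (y ▸ ε) p) (absorb (c ⊕ (y ▸ ε)) p q)

-- One rotation per unit of slack, so the length is attained: first the trees of `p` are absorbed,
-- then the children and finally the right siblings are rotated.
≼⇒Steps : ∀ {F G d} → F ≼ G [ d ] → Steps F G d
≼⇒Steps ε = []
≼⇒Steps (graft {c₁} {c₂ = c₂} p {q} refl s t) =
  Steps-trans (absorb c₁ p q)
    (Steps-trans (Steps-map (_▸ q) inner (≼⇒Steps s)) (Steps-map (c₂ ▸_) outer (≼⇒Steps t)))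

node-injectiveˡ : ∀ {l l′ r r′ : Tree} → Tree.node l r ≡ node l′ r′ → l ≡ l′
node-injectiveˡ refl = refl

node≢left : ∀ {l r : Tree} → Tree.node l r ≢ l
node≢left {node _ _} eq = node≢left (node-injectiveˡ eq)

-- Needed because `Chain` asks for distinct trees. At the root, the left subtree `node A B` is
-- replaced by its own left subtree `A`.
Rot-irrefl : ∀ {s t} → Rot s t → s ≢ t
Rot-irrefl rot       eq   = node≢left (node-injectiveˡ eq)
Rot-irrefl (left s)  refl = Rot-irrefl s refl
Rot-irrefl (right s) refl = Rot-irrefl s refl

Steps⇒Chain : ∀ {F G d} → Steps F G d → Chain (toTree F) (toTree G) d
Steps⇒Chain []      = []
Steps⇒Chain (s ∷ u) = (ρ ◅ done , Rot-irrefl ρ) ∷ Steps⇒Chain u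
  where ρ = ↝⇒Rot leaf s

≤T-≼ : ∀ {s t G d} → s ≤T t → toForest t ≼ G [ d ] → ∃ λ e → d ≤ e × toForest s ≼ G [ e ]
≤T-≼ done    u = _ , ≤-refl , u
≤T-≼ (ρ ◅ s) u with ≤T-≼ s u
... | e , d≤e , v with ↝-≼ (Rot⇒↝ ρ) v
...   | f , e<f , w = f , ≤-trans d≤e (<⇒≤ e<f) , w

<T-≼ : ∀ {s t G d} → s <T t → toForest t ≼ G [ d ] → ∃ λ e → d < e × toForest s ≼ G [ e ]
<T-≼ (done , s≢s)  u = contradiction refl s≢s
<T-≼ (ρ ◅ s , _) u with ≤T-≼ s u
... | e , d≤e , v with ↝-≼ (Rot⇒↝ ρ) v
...   | f , e<f , w = f , ≤-<-trans d≤e e<f , w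

-- Descending from the trivial interval at the top, each strict step adds at least one to the slack.
Chain⇒≼ : ∀ {s t k} → Chain s t k → ∃ λ d → k ≤ d × toForest s ≼ toForest t [ d ]
Chain⇒≼ [] = 0 , z≤n , ≼-refl _
Chain⇒≼ (s ∷ c) with Chain⇒≼ c
... | d , k≤d , u with <T-≼ s u
...   | e , d<e , v = e , ≤-<-trans k≤d d<e , v

DistT : Tree → Tree → ℕ → Set
DistT s t d = Chain s t d × (∀ k → Chain s t k → k ≤ d)

≼⇒DistT : ∀ {F G d} → F ≼ G [ d ] → DistT (toTree F) (toTree G) d
≼⇒DistT {F} {G} {d} u = Steps⇒Chain (≼⇒Steps u) , λ k c → bound k (Chain⇒≼ c)
  where
  bound : ∀ k → (∃ λ e → k ≤ e × toForest (toTree F) ≼ toForest (toTree G) [ e ]) → k ≤ d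
  bound k (e , k≤e , v) rewrite toForest-toTree F | toForest-toTree G =
    ≤-trans k≤e (≤-reflexive (trans (sym (slack≡ v)) (slack≡ u)))
    where
    slack≡ : ∀ {e} → F ≼ G [ e ] → slack (label F G) ≡ e
    slack≡ w = proj₂ (proj₂ (proj₂ (label-≼ w)))

-- A chain of length `d` yields an interval of some length `e ≥ d`; its rotations form a chain of
-- length `e`, so maximality gives `e ≤ d`.
DistT⇒≼ : ∀ {F G d} → DistT (toTree F) (toTree G) d → F ≼ G [ d ]
DistT⇒≼ {F} {G} {d} (c , max) with Chain⇒≼ c
... | e , d≤e , u rewrite toForest-toTree F | toForest-toTree G =
  subst (F ≼ G [_]) (≤-antisym (max e (Steps⇒Chain (≼⇒Steps u))) d≤e) u

-- The involution on intervals

flip : Tree → Tree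
flip leaf       = leaf
flip (node l r) = node (flip r) (flip l)

flip-involutive : ∀ t → flip (flip t) ≡ t
flip-involutive leaf       = refl
flip-involutive (node l r) = cong₂ node (flip-involutive l) (flip-involutive r)

-- The two sides of the rotation are mirror images of each other up to renaming the subtrees, so
-- flipping swaps them.
flip-Rot : ∀ {s t} → Rot s t → Rot (flip t) (flip s)
flip-Rot rot       = rot
flip-Rot (left s)  = right (flip-Rot s)
flip-Rot (right s) = left (flip-Rot s)

flip-≤T : ∀ {s t} → s ≤T t → flip t ≤T flip s
flip-≤T done    = done
flip-≤T (ρ ◅ s) = flip-≤T s ◅◅ (flip-Rot ρ ◅ done)

flip-<T : ∀ {s t} → s <T t → flip t <T flip s
flip-<T {s} {t} (s≤t , s≢t) = flip-≤T s≤t , λ eq →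
  s≢t (trans (sym (flip-involutive s)) (trans (cong flip (sym eq)) (flip-involutive t)))

Chain-∷ʳ : ∀ {s t u k} → Chain s t k → t <T u → Chain s u (suc k)
Chain-∷ʳ []      l = l ∷ []
Chain-∷ʳ (x ∷ c) l = x ∷ Chain-∷ʳ c l

flip-Chain : ∀ {s t k} → Chain s t k → Chain (flip t) (flip s) k
flip-Chain []      = []
flip-Chain (l ∷ c) = Chain-∷ʳ (flip-Chain c) (flip-<T l)

flip-DistT : ∀ {s t d} → DistT s t d → DistT (flip t) (flip s) d
flip-DistT {s} {t} (c , max) = flip-Chain c , λ k c′ →
  max k (subst₂ (λ u v → Chain u v k) (flip-involutive s) (flip-involutive t) (flip-Chain c′))

dual : Plane → Plane
dual F = toForest (flip (toTree F))

dual-involutive : ∀ F → dual (dual F) ≡ F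
dual-involutive F = begin
  toForest (flip (toTree (toForest (flip (toTree F))))) ≡⟨ cong (λ t → toForest (flip t)) (toTree-toForest (flip (toTree F))) ⟩
  toForest (flip (flip (toTree F)))                     ≡⟨ cong toForest (flip-involutive (toTree F)) ⟩
  toForest (toTree F)                                   ≡⟨ toForest-toTree F ⟩
  F                                                     ∎
  where open ≡-Reasoning

-- The detour through `DistT` carries the length over by reversing chains, without comparing slacks
-- on the two sides.
dual-≼ : ∀ {F G d} → F ≼ G [ d ] → dual G ≼ dual F [ d ]
dual-≼ {F} {G} {d} u = DistT⇒≼ (subst₂ (λ s t → DistT s t d)
  (sym (toTree-toForest _)) (sym (toTree-toForest _)) (flip-DistT (≼⇒DistT u)))

size-dual : ∀ F → size (dual F) ≡ size F
size-dual F = trans (size-flip (toTree F)) (cong size (toForest-toTree F))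
  where
  size-node : ∀ l r → size (toForest (node l r)) ≡ suc (size (toForest l) + size (toForest r))
  size-node l r = trans (size-⊕ (toForest l) _)
    (trans (+-suc (size (toForest l)) _) (cong (λ k → suc (size (toForest l) + k)) (+-identityʳ _)))

  size-flip : ∀ t → size (toForest (flip t)) ≡ size (toForest t)
  size-flip leaf = refl
  size-flip (node l r) = trans (size-node (flip r) (flip l))
    (trans (cong suc (trans (cong₂ _+_ (size-flip r) (size-flip l)) (+-comm (size (toForest r)) _)))
           (sym (size-node l r)))

-- The child counts of reread F, in preorder, are the rises of word F: see leadingUps-word
-- and afterDowns-word.
reread : Plane → Plane
reread F = dual (mirror F)

-- In the binary tree of `mirror (c ▸ r)` the root has `mirror r` on its left and `mirror c` on its
-- right. The flip exchanges them: `c` yields the earlier siblings and `r` the children.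
reread-▸ : ∀ c r → reread (c ▸ r) ≡ reread c ⊕ (reread r ▸ ε)
reread-▸ c r = cong (λ t → toForest (flip t)) (extend-⊕ leaf (mirror r) (mirror c ▸ ε))

Pair : Set
Pair = Plane × Plane

reflect : Pair → Pair
reflect (F , G) = let x = mirror (label F G) in lower x , shape x

transpose : Pair → Pair
transpose (F , G) = dual G , dual F

_≼²_ : Pair → ℕ → Set
(F , G) ≼² d = F ≼ G [ d ]

record Reflected (I : Pair) (d : ℕ) : Set where
  field
    isInterval : reflect I ≼² d
    involutive : reflect (reflect I) ≡ I
    upper-mirror : proj₂ (reflect I) ≡ mirror (proj₂ I)
    lower-len : len (proj₁ (reflect I)) ≡ len (proj₁ I)
    lower-code : code (proj₁ (reflect I)) ↭ code (proj₁ I)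

-- Everything is read off the labelling `x`: `label` recovers `x′` from the reflected pair, so
-- reflecting twice is mirroring twice.
reflect-≼ : ∀ I d → I ≼² d → Reflected I d
reflect-≼ (F , G) d u = record
  { isInterval   = subst (lower x′ ≼ shape x′ [_]) (trans (slack-mirror x) sx) (lower≼shape x′ vx′)
  ; involutive   = trans (cong (λ y → lower (mirror y) , shape (mirror y)) (label-lower-shape x′ vx′))
                   (trans (cong (λ y → lower y , shape y) (mirror-involutive x)) (cong₂ _,_ lx gx))
  ; upper-mirror = trans (shape-mirror x) (cong mirror gx)
  ; lower-len    = trans (len-lower x′) (trans (width-mirror x) (trans (sym (len-lower x)) (cong len lx)))
  ; lower-code   = ↭-trans (↭-reflexive (code-lower x′ vx′)) (↭-trans (labels-mirror x)
                     (↭-reflexive (trans (sym (code-lower x vx)) (cong code lx))))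
  }
  where
  x  = label F G
  x′ = mirror x
  vx = proj₁ (label-≼ u)
  lx = proj₁ (proj₂ (label-≼ u))
  gx = proj₁ (proj₂ (proj₂ (label-≼ u)))
  sx = proj₂ (proj₂ (proj₂ (label-≼ u)))
  vx′ = valid-mirror x vx

transpose-involutive : ∀ I → transpose (transpose I) ≡ I
transpose-involutive (F , G) = cong₂ _,_ (dual-involutive F) (dual-involutive G)

riseContact : Pair → Pair
riseContact I = reflect (transpose (reflect I))

record Exchanged (I : Pair) (d : ℕ) : Set where
  private K = riseContact I
  field
    isInterval   : K ≼² d
    involutive   : riseContact K ≡ I
    lower-len    : len (proj₁ K) ≡ len (reread (proj₂ I))
    lower-code   : code (proj₁ K) ↭ code (reread (proj₂ I))
    upper-len    : len (reread (proj₂ K)) ≡ len (proj₁ I)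
    upper-code   : code (reread (proj₂ K)) ↭ code (proj₁ I)
    upper-size   : size (proj₂ K) ≡ size (proj₁ I)

riseContact-≼ : ∀ I d → I ≼² d → Exchanged I d
riseContact-≼ I d u = record
  { isInterval = B.isInterval
  -- A conjugate of the involution `transpose` by the involution `reflect`.
  ; involutive = trans (cong (λ X → reflect (transpose X)) B.involutive)
                 (trans (cong reflect (transpose-involutive I′)) A.involutive)
  ; lower-len  = trans B.lower-len (cong (λ F → len (dual F)) A.upper-mirror)
  ; lower-code = ↭-trans B.lower-code (↭-reflexive (cong (λ F → code (dual F)) A.upper-mirror))
  ; upper-len  = trans (cong len reread-upper) A.lower-len
  ; upper-code = ↭-trans (↭-reflexive (cong code reread-upper)) A.lower-code
  ; upper-size = begin
      size (proj₂ K)                  ≡⟨ cong size B.upper-mirror ⟩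
      size (mirror (dual (proj₁ I′))) ≡⟨ size-mirror (dual (proj₁ I′)) ⟩
      size (dual (proj₁ I′))          ≡⟨ size-dual (proj₁ I′) ⟩
      size (proj₁ I′)                 ≡⟨ length-code (proj₁ I′) ⟨
      length (code (proj₁ I′))        ≡⟨ Perm.↭-length A.lower-code ⟩
      length (code (proj₁ I))         ≡⟨ length-code (proj₁ I) ⟩
      size (proj₁ I)                  ∎
  }
  where
  open ≡-Reasoning
  I′ = reflect I
  K  = riseContact I
  module A = Reflected (reflect-≼ I d u)
  module B = Reflected (reflect-≼ (transpose I′) d (dual-≼ A.isInterval))

  -- The upper forest of `K` is `mirror (dual (proj₁ I′))`, and `reread` undoes both maps.
  reread-upper : reread (proj₂ K) ≡ proj₁ I′
  reread-upper = trans (cong (λ F → dual (mirror F)) B.upper-mirror)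
    (trans (cong dual (mirror-involutive (dual (proj₁ I′)))) (dual-involutive (proj₁ I′)))

-- Dyck words

word : Plane → List Bool
word ε       = []
word (c ▸ r) = true ∷ word c ++ false ∷ word r

word-▸-++ : ∀ c r v → word (c ▸ r) ++ v ≡ true ∷ word c ++ false ∷ (word r ++ v)
word-▸-++ c r v = cong (true ∷_) (List.++-assoc (word c) (false ∷ word r) v)

word-⊕ : ∀ F G → word (F ⊕ G) ≡ word F ++ word G
word-⊕ ε       G = refl
word-⊕ (c ▸ r) G = trans (cong (λ w → true ∷ word c ++ false ∷ w) (word-⊕ r G)) (sym (word-▸-++ c r (word G)))

length-word : ∀ F → length (word F) ≡ 2 * size F
length-word ε = refl
length-word (c ▸ r) = begin
  suc (length (word c ++ false ∷ word r))         ≡⟨ cong suc (List.length-++ (word c)) ⟩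
  suc (length (word c) + suc (length (word r)))   ≡⟨ cong suc (+-suc (length (word c)) _) ⟩
  2 + (length (word c) + length (word r))         ≡⟨ cong (λ k → 2 + k) (cong₂ _+_ (length-word c) (length-word r)) ⟩
  2 + (2 * size c + 2 * size r)                   ≡⟨ cong (λ k → 2 + k) (*-distribˡ-+ 2 (size c) (size r)) ⟨
  2 + 2 * (size c + size r)                       ≡⟨ *-suc 2 (size c + size r) ⟨
  2 * suc (size c + size r)                       ∎
  where open ≡-Reasoning

-- Suffixes of Dyck words, indexed by their starting height; natural numbers as heights build in
-- that the path stays above the axis.
data Path : ℕ → List Bool → Set where
  []   : Path 0 []
  up   : ∀ {h w} → Path (suc h) w → Path h (true ∷ w)
  down : ∀ {h w} → Path h w → Path (suc h) (false ∷ w)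

path-word : ∀ {h v} F → Path h v → Path h (word F ++ v)
path-word ε P = P
path-word {h} {v} (c ▸ r) P =
  subst (Path h) (sym (word-▸-++ c r v)) (up (path-word c (down (path-word r P))))

+-up : ∀ h z → + h ℤ.+ (+ 1 ℤ.+ z) ≡ + suc h ℤ.+ z
+-up h z = trans (sym (ℤ.+-assoc (+ h) (+ 1) z)) (cong (λ k → + k ℤ.+ z) (+-comm h 1))

+-down : ∀ h z → + suc h ℤ.+ (-[1+ 0 ] ℤ.+ z) ≡ + h ℤ.+ z
+-down h z = sym (ℤ.+-assoc (+ suc h) -[1+ 0 ] z)

path-height : ∀ {h w} → Path h w → + h ℤ.+ height w ≡ + 0
path-height []               = refl
path-height (up {h} {w} P)   = trans (+-up h (height w)) (path-height P)
path-height (down {h} {w} P) = trans (+-down h (height w)) (path-height P)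

path-prefix : ∀ {h w} → Path h w → ∀ i → ∃ λ k → + h ℤ.+ height (take i w) ≡ + k
path-prefix {h} P                zero    = h , ℤ.+-identityʳ (+ h)
path-prefix []               (suc i) = 0 , refl
path-prefix (up {h} {w} P)   (suc i) = let k , eq = path-prefix P i in k , trans (+-up h (height (take i w))) eq
path-prefix (down {h} {w} P) (suc i) = let k , eq = path-prefix P i in k , trans (+-down h (height (take i w))) eq

word-Path : ∀ F → Path 0 (word F)
word-Path F = subst (Path 0) (List.++-identityʳ (word F)) (path-word F [])

height-word : ∀ F → height (word F) ≡ + 0
height-word F = trans (sym (ℤ.+-identityˡ _)) (path-height (word-Path F))

height-prefix : ∀ F i → ∃ λ k → height (take i (word F)) ≡ + k
height-prefix F i = let k , eq = path-prefix (word-Path F) i in k , trans (sym (ℤ.+-identityˡ _)) eq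

word-IsDyck : ∀ {n} F → size F ≡ n → IsDyck n (word F)
word-IsDyck F refl = length-word F , height-word F , λ i _ →
  let k , eq = height-prefix F i in subst (+ 0 ℤ.≤_) (sym eq) (ℤ.+≤+ z≤n)

toPath : ∀ h w → + h ℤ.+ height w ≡ + 0 → (∀ i → i ≤ length w → + 0 ℤ.≤ + h ℤ.+ height (take i w)) → Path h w
toPath h [] eq _ with trans (sym (ℤ.+-identityʳ (+ h))) eq
... | refl = []
toPath h (true ∷ w) eq nn = up (toPath (suc h) w (trans (sym (+-up h (height w))) eq)
  λ i i≤ → subst (+ 0 ℤ.≤_) (+-up h (height (take i w))) (nn (suc i) (s≤s i≤)))
toPath zero (false ∷ w) eq nn = contradiction (nn 1 (s≤s z≤n)) λ ()
toPath (suc h) (false ∷ w) eq nn = down (toPath h w (trans (sym (+-down h (height w))) eq)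
  λ i i≤ → subst (+ 0 ℤ.≤_) (+-down h (height (take i w))) (nn (suc i) (s≤s i≤)))

-- A path from height `h` down to 0 has `h` unmatched down-steps, and these separate `h + 1` Dyck
-- words.
flat : Plane → List Plane → List Bool
flat F []       = word F
flat F (G ∷ Gs) = word F ++ false ∷ flat G Gs

flat-▸ : ∀ c r Fs → true ∷ flat c (r ∷ Fs) ≡ flat (c ▸ r) Fs
flat-▸ c r []       = refl
flat-▸ c r (G ∷ Gs) = sym (word-▸-++ c r (false ∷ flat G Gs))

parsePath : ∀ {h w} → Path h w → ∃ λ F → ∃ λ Fs → length Fs ≡ h × w ≡ flat F Fs
parsePath [] = ε , [] , refl , refl
parsePath (down P) with parsePath P
... | F , Fs , l , refl = ε , F ∷ Fs , cong suc l , refl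
-- The new up-step is matched by the first unmatched down-step, which joins the first two forests.
parsePath (up P) with parsePath P
... | c , r ∷ Fs , l , refl = c ▸ r , Fs , suc-injective l , flat-▸ c r Fs

IsDyck⇒word : ∀ {n w} → IsDyck n w → ∃ λ F → size F ≡ n × w ≡ word F
IsDyck⇒word {n} {w} (l , h , nn)
  with parsePath (toPath 0 w (trans (ℤ.+-identityˡ _) h) (λ i i≤ → subst (+ 0 ℤ.≤_) (sym (ℤ.+-identityˡ _)) (nn i i≤)))
... | F , [] , _ , refl = F , *-cancelˡ-≡ (size F) n 2 (trans (sym (length-word F)) l) , refl

-- Contacts and rises of contour words.

tally : (ℕ → Bool) → ℕ → ℕ
tally p zero    = 0
tally p (suc n) = (if p 0 then 1 else 0) + tally (p ∘ suc) n

tally-cong : ∀ {p q} → (∀ i → p i ≡ q i) → ∀ n → tally p n ≡ tally q n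
tally-cong p≗q zero    = refl
tally-cong p≗q (suc n) = cong₂ (λ b k → (if b then 1 else 0) + k) (p≗q 0) (tally-cong (p≗q ∘ suc) n)

length-filter-applyUpTo : ∀ {P : ℕ → Set} (P? : Decidable P) f n →
  length (filter P? (applyUpTo f n)) ≡ tally (λ i → does (P? (f i))) n
length-filter-applyUpTo P? f zero = refl
length-filter-applyUpTo P? f (suc n) with does (P? (f 0))
... | true  = cong suc (length-filter-applyUpTo P? (f ∘ suc) n)
... | false = length-filter-applyUpTo P? (f ∘ suc) n

-- The starting height is a parameter so that the count can be carried along the word. The final
-- point is left out, as in `contacts`.
zeros : ℤ → List Bool → ℕ
zeros h w = tally (λ i → does (h ℤ.+ height (take i w) ℤ.≟ + 0)) (length w)

zeros-∷ : ∀ h b w → zeros h (b ∷ w) ≡ (if does (h ℤ.≟ + 0) then 1 else 0) + zeros (h ℤ.+ step b) w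
zeros-∷ h b w = cong₂ (λ z k → (if does (z ℤ.≟ + 0) then 1 else 0) + k) (ℤ.+-identityʳ h)
  (tally-cong (λ i → cong (λ z → does (z ℤ.≟ + 0)) (sym (ℤ.+-assoc h (step b) _))) (length w))

zeros-up : ∀ h w → zeros (+ h) (true ∷ w) ≡ (if does (+ h ℤ.≟ + 0) then 1 else 0) + zeros (+ suc h) w
zeros-up h w = trans (zeros-∷ (+ h) true w)
  (cong (λ k → (if does (+ h ℤ.≟ + 0) then 1 else 0) + zeros (+ k) w) (+-comm h 1))

-- Along `word F` the path stays at height `suc h` or above, so it never meets 0.
zeros-suc : ∀ h F v → zeros (+ suc h) (word F ++ v) ≡ zeros (+ suc h) v
zeros-suc h ε v = refl
zeros-suc h (c ▸ r) v = begin
  zeros (+ suc h) (word (c ▸ r) ++ v)                       ≡⟨ cong (zeros (+ suc h)) (word-▸-++ c r v) ⟩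
  zeros (+ suc h) (true ∷ word c ++ false ∷ (word r ++ v))  ≡⟨ zeros-up (suc h) (word c ++ false ∷ (word r ++ v)) ⟩
  zeros (+ suc (suc h)) (word c ++ false ∷ (word r ++ v))   ≡⟨ zeros-suc (suc h) c (false ∷ (word r ++ v)) ⟩
  zeros (+ suc (suc h)) (false ∷ (word r ++ v))             ≡⟨ zeros-∷ (+ suc (suc h)) false (word r ++ v) ⟩
  zeros (+ suc h) (word r ++ v)                             ≡⟨ zeros-suc h r v ⟩
  zeros (+ suc h) v                                         ∎
  where open ≡-Reasoning

zeros-word : ∀ F → zeros (+ 0) (word F) ≡ len F
zeros-word ε = refl
zeros-word (c ▸ r) = begin
  zeros (+ 0) (true ∷ word c ++ false ∷ word r)  ≡⟨ zeros-up 0 (word c ++ false ∷ word r) ⟩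
  suc (zeros (+ 1) (word c ++ false ∷ word r))   ≡⟨ cong suc (zeros-suc 0 c (false ∷ word r)) ⟩
  suc (zeros (+ 1) (false ∷ word r))             ≡⟨ cong suc (zeros-∷ (+ 1) false (word r)) ⟩
  suc (zeros (+ 0) (word r))                     ≡⟨ cong suc (zeros-word r) ⟩
  suc (len r)                                    ∎
  where open ≡-Reasoning

contacts-word : ∀ F → contacts (word F) ≡ len F
contacts-word F = begin
  contacts (word F)     ≡⟨ length-filter-applyUpTo (λ i → height (take i (word F)) ℤ.≟ + 0) id (length (word F)) ⟩
  tally (λ i → does (height (take i (word F)) ℤ.≟ + 0)) (length (word F))
    ≡⟨ tally-cong (λ i → cong (λ z → does (z ℤ.≟ + 0)) (sym (ℤ.+-identityˡ (height (take i (word F)))))) (length (word F)) ⟩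
  zeros (+ 0) (word F)  ≡⟨ zeros-word F ⟩
  len F                 ∎
  where open ≡-Reasoning

truncate : ℤ → List Bool → List Bool
truncate h []      = []
truncate h (b ∷ w) with (h ℤ.+ step b) ℤ.<? + 0
... | yes _ = []
... | no  _ = b ∷ truncate (h ℤ.+ step b) w

-- The local function of maxDyckPrefix has no name here; abstracting its
-- starting height + 0 lets unification supply it as the left-hand side of go≡truncate.
mutual
  maxDyckPrefix≡truncate : ∀ w → maxDyckPrefix w ≡ truncate (+ 0) w
  maxDyckPrefix≡truncate w with + 0
  ... | h = go≡truncate h w

  go≡truncate : ∀ h w → _ ≡ truncate h w
  go≡truncate h [] = refl
  go≡truncate h (b ∷ w) with (h ℤ.+ step b) ℤ.<? + 0
  ... | yes _ = refl
  ... | no  _ = cong (b ∷_) (go≡truncate (h ℤ.+ step b) w)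

truncate-up : ∀ h w → truncate (+ h) (true ∷ w) ≡ true ∷ truncate (+ suc h) w
truncate-up h w rewrite +-comm h 1 = refl

truncate-word : ∀ h F v → truncate (+ h) (word F ++ v) ≡ word F ++ truncate (+ h) v
truncate-word h ε v = refl
truncate-word h (c ▸ r) v = begin
  truncate (+ h) (word (c ▸ r) ++ v)                            ≡⟨ cong (truncate (+ h)) (word-▸-++ c r v) ⟩
  truncate (+ h) (true ∷ word c ++ false ∷ (word r ++ v))       ≡⟨ truncate-up h (word c ++ false ∷ (word r ++ v)) ⟩
  true ∷ truncate (+ suc h) (word c ++ false ∷ (word r ++ v))   ≡⟨ cong (true ∷_) (truncate-word (suc h) c (false ∷ (word r ++ v))) ⟩
  true ∷ word c ++ false ∷ truncate (+ h) (word r ++ v)         ≡⟨ cong (λ u → true ∷ word c ++ false ∷ u) (truncate-word h r v) ⟩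
  true ∷ word c ++ false ∷ (word r ++ truncate (+ h) v)         ≡⟨ word-▸-++ c r _ ⟨
  word (c ▸ r) ++ truncate (+ h) v                              ∎
  where open ≡-Reasoning

maxDyckPrefix-word : ∀ F v → maxDyckPrefix (word F ++ false ∷ v) ≡ word F
maxDyckPrefix-word F v = trans (maxDyckPrefix≡truncate (word F ++ false ∷ v))
  (trans (truncate-word 0 F (false ∷ v)) (List.++-identityʳ (word F)))

map-upTo-suc : ∀ {A : Set} (f : ℕ → A) n → map f (upTo (suc n)) ≡ f 0 ∷ map (f ∘ suc) (upTo n)
map-upTo-suc f n = cong (f 0 ∷_) (trans (List.map-applyUpTo suc f n) (sym (List.map-upTo (f ∘ suc) n)))

-- Collecting all suffixes at once replaces the index of `afterUp` and `afterDown` by recursion on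
-- the word.
afterUps afterDowns : List Bool → List (List Bool)
afterUps []          = []
afterUps (true ∷ w)  = w ∷ afterUps w
afterUps (false ∷ w) = afterUps w
afterDowns []          = []
afterDowns (true ∷ w)  = afterDowns w
afterDowns (false ∷ w) = w ∷ afterDowns w

map-afterUp : ∀ w n → n ≤ length (afterUps w) → map (λ i → afterUp (suc i) w) (upTo n) ≡ take n (afterUps w)
map-afterUp w zero _ = refl
map-afterUp (true ∷ w) (suc n) (s≤s n≤) = trans (map-upTo-suc (λ i → afterUp (suc i) (true ∷ w)) n) (cong (w ∷_) (map-afterUp w n n≤))
map-afterUp (false ∷ w) (suc n) n≤ = trans (List.map-cong skip (upTo (suc n))) (map-afterUp w (suc n) n≤)
  where
  skip : ∀ i → afterUp (suc i) (false ∷ w) ≡ afterUp (suc i) w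
  skip zero    = refl
  skip (suc i) = refl

map-afterDown : ∀ w n → n ≤ length (afterDowns w) → map (λ i → afterDown (suc i) w) (upTo n) ≡ take n (afterDowns w)
map-afterDown w zero _ = refl
map-afterDown (false ∷ w) (suc n) (s≤s n≤) = trans (map-upTo-suc (λ i → afterDown (suc i) (false ∷ w)) n) (cong (w ∷_) (map-afterDown w n n≤))
map-afterDown (true ∷ w) (suc n) n≤ = trans (List.map-cong skip (upTo (suc n))) (map-afterDown w (suc n) n≤)
  where
  skip : ∀ i → afterDown (suc i) (true ∷ w) ≡ afterDown (suc i) w
  skip zero    = refl
  skip (suc i) = refl

contactsAfter : List Bool → ℕ
contactsAfter w = contacts (maxDyckPrefix w)

-- The up-steps come in the preorder of the nodes, and what follows the up-step of a node is the
-- word of its children and the matching down-step.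
afterUps-word : ∀ F v → map contactsAfter (afterUps (word F ++ v)) ≡ code F ++ map contactsAfter (afterUps v)
afterUps-word ε v = refl
afterUps-word (c ▸ r) v = begin
  map contactsAfter (afterUps (word (c ▸ r) ++ v))
    ≡⟨ cong (map contactsAfter ∘ afterUps) (word-▸-++ c r v) ⟩
  contactsAfter (word c ++ false ∷ (word r ++ v)) ∷ map contactsAfter (afterUps (word c ++ false ∷ (word r ++ v)))
    ≡⟨ cong₂ _∷_ (trans (cong contacts (maxDyckPrefix-word c _)) (contacts-word c))
                 (trans (afterUps-word c _) (cong (code c ++_) (afterUps-word r v))) ⟩
  len c ∷ code c ++ (code r ++ map contactsAfter (afterUps v))
    ≡⟨ cong (len c ∷_) (List.++-assoc (code c) (code r) _) ⟨
  code (c ▸ r) ++ map contactsAfter (afterUps v) ∎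
  where open ≡-Reasoning

len-reread-▸ : ∀ c r → len (reread (c ▸ r)) ≡ suc (len (reread c))
len-reread-▸ c r = trans (cong len (reread-▸ c r)) (trans (len-⊕ (reread c) _) (+-comm _ 1))

code-reread-▸ : ∀ c r → code (reread (c ▸ r)) ≡ code (reread c) ++ len (reread r) ∷ code (reread r)
code-reread-▸ c r = trans (cong code (reread-▸ c r)) (trans (code-⊕ (reread c) _)
  (cong (λ k → code (reread c) ++ len (reread r) ∷ k) (List.++-identityʳ _)))

-- The initial rise follows the chain of first children, and by `reread-▸` each of them adds one
-- tree to the reread forest. The condition on `v` keeps the rise from running on into `v`.
leadingUps-word : ∀ F v → leadingUps v ≡ 0 → leadingUps (word F ++ v) ≡ len (reread F)
leadingUps-word ε v eq = eq
leadingUps-word (c ▸ r) v eq = begin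
  leadingUps (word (c ▸ r) ++ v)                         ≡⟨ cong leadingUps (word-▸-++ c r v) ⟩
  suc (leadingUps (word c ++ false ∷ (word r ++ v)))     ≡⟨ cong suc (leadingUps-word c _ refl) ⟩
  suc (len (reread c))                                   ≡⟨ len-reread-▸ c r ⟨
  len (reread (c ▸ r))                                   ∎
  where open ≡-Reasoning

-- The down-step closing the first tree is followed by `word r`, whose rise is `len (reread r)`: the
-- child count of the last tree of `reread (c ▸ r)`.
afterDowns-word : ∀ F v → leadingUps v ≡ 0 →
  map leadingUps (afterDowns (word F ++ v)) ≡ code (reread F) ++ map leadingUps (afterDowns v)
afterDowns-word ε v eq = refl
afterDowns-word (c ▸ r) v eq = begin
  map leadingUps (afterDowns (word (c ▸ r) ++ v))
    ≡⟨ cong (map leadingUps ∘ afterDowns) (word-▸-++ c r v) ⟩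
  map leadingUps (afterDowns (word c ++ false ∷ (word r ++ v)))
    ≡⟨ afterDowns-word c _ refl ⟩
  code (reread c) ++ leadingUps (word r ++ v) ∷ map leadingUps (afterDowns (word r ++ v))
    ≡⟨ cong₂ (λ k ks → code (reread c) ++ k ∷ ks) (leadingUps-word r v eq) (afterDowns-word r v eq) ⟩
  code (reread c) ++ (len (reread r) ∷ code (reread r) ++ map leadingUps (afterDowns v))
    ≡⟨ List.++-assoc (code (reread c)) _ _ ⟨
  (code (reread c) ++ len (reread r) ∷ code (reread r)) ++ map leadingUps (afterDowns v)
    ≡⟨ cong (_++ _) (code-reread-▸ c r) ⟨
  code (reread (c ▸ r)) ++ map leadingUps (afterDowns v) ∎
  where open ≡-Reasoning

-- Contact and rise monomials.

monomial : ℕ → Plane → List ℕ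
monomial n F = len F ∷ take (n ∸ 1) (code F)

map-oneTo : ∀ {A : Set} (g : A → ℕ) (f : ℕ → A) xs F → map g xs ≡ code F →
  (∀ n → n ≤ length xs → map (f ∘ suc) (upTo n) ≡ take n xs) →
  map (g ∘ f) (oneTo (size F)) ≡ take (size F ∸ 1) (code F)
map-oneTo g f xs F eq fs = begin
  map (g ∘ f) (map suc (upTo m))  ≡⟨ List.map-∘ (upTo m) ⟨
  map (g ∘ f ∘ suc) (upTo m)      ≡⟨ List.map-∘ (upTo m) ⟩
  map g (map (f ∘ suc) (upTo m))  ≡⟨ cong (map g) (fs m m≤) ⟩
  map g (take m xs)               ≡⟨ List.take-map m xs ⟨
  take m (map g xs)               ≡⟨ cong (take m) eq ⟩
  take m (code F)                 ∎
  where
  open ≡-Reasoning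
  m = size F ∸ 1
  m≤ : m ≤ length xs
  m≤ = ≤-trans (m∸n≤m (size F) 1)
    (≤-reflexive (trans (sym (length-code F)) (trans (cong length (sym eq)) (List.length-map g xs))))

contactMon-word : ∀ F → contactMon (size F) (word F) ≡ monomial (size F) F
contactMon-word F = cong₂ _∷_ (contacts-word F)
  (map-oneTo contactsAfter (λ i → afterUp i (word F)) (afterUps (word F)) F
    (subst (λ w → map contactsAfter (afterUps w) ≡ code F) (List.++-identityʳ (word F))
      (trans (afterUps-word F []) (List.++-identityʳ (code F))))
    (map-afterUp (word F)))

rises-word : ∀ F → rises (word F) ≡ len (reread F)
rises-word F = trans (cong leadingUps (sym (List.++-identityʳ (word F)))) (leadingUps-word F [] refl)

size-reread : ∀ F → size (reread F) ≡ size F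
size-reread F = trans (size-dual (mirror F)) (size-mirror F)

riseMon-word : ∀ F → riseMon (size F) (word F) ≡ monomial (size F) (reread F)
riseMon-word F = cong₂ _∷_ (rises-word F)
  (subst (λ n → map (λ i → risesᵢ i (word F)) (oneTo n) ≡ take (n ∸ 1) (code (reread F))) (size-reread F)
    (map-oneTo leadingUps (λ i → afterDown i (word F)) (afterDowns (word F)) (reread F)
      (subst (λ w → map leadingUps (afterDowns w) ≡ code (reread F)) (List.++-identityʳ (word F))
        (trans (afterDowns-word F [] refl) (List.++-identityʳ (code (reread F)))))
      (map-afterDown (word F))))

code-▸-∷ʳ : ∀ c r → ∃ λ ks → code (c ▸ r) ≡ ks ∷ʳ 0
code-▸-∷ʳ ε       ε         = [] , refl
code-▸-∷ʳ (c ▸ s) ε         with code-▸-∷ʳ c s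
... | ks , eq = len (c ▸ s) ∷ ks , cong (len (c ▸ s) ∷_) (trans (List.++-identityʳ _) eq)
code-▸-∷ʳ c       (c′ ▸ r′) with code-▸-∷ʳ c′ r′
... | ks , eq = len c ∷ code c ++ ks , cong (len c ∷_) (trans (cong (code c ++_) eq) (sym (List.++-assoc (code c) ks _)))

-- The letter missing from a monomial is the child count of the last node in preorder, which is 0.
monomial-↭ : ∀ {F G} → len F ≡ len G → code F ↭ code G → monomial (size F) F ↭ monomial (size F) G
monomial-↭ {ε} {ε} _ _ = ↭-refl
monomial-↭ {c ▸ r} {c′ ▸ r′} l p with code-▸-∷ʳ c r | code-▸-∷ʳ c′ r′
... | ks , eq | ks′ , eq′ = ↭-trans (↭-reflexive (cong₂ _∷_ l (take-init (length-code (c ▸ r)) eq)))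
  (↭-trans (prep _ (Perm.drop-∷ ks↭ks′))
    (↭-reflexive (cong (_ ∷_) (sym (take-init (trans (sym (Perm.↭-length p)) (length-code (c ▸ r))) eq′)))))
  where
  take-init : ∀ {xs ys : List ℕ} {m} → length xs ≡ suc m → xs ≡ ys ∷ʳ 0 → take m xs ≡ ys
  take-init {ys = ys} le refl with suc-injective (trans (sym le) (trans (List.length-++ ys) (+-comm (length ys) 1)))
  ... | refl = go ys
    where
    go : ∀ ys → take (length ys) (ys ∷ʳ 0) ≡ ys
    go []       = refl
    go (y ∷ ys) = cong (y ∷_) (go ys)

  -- The final zeros are moved to the front, where they can be cancelled.
  ks↭ks′ : 0 ∷ ks ↭ 0 ∷ ks′
  ks↭ks′ = ↭-trans (Perm.∷↭∷ʳ 0 ks) (↭-trans (↭-reflexive (sym eq))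
    (↭-trans p (↭-trans (↭-reflexive eq′) (↭-sym (Perm.∷↭∷ʳ 0 ks′)))))

-- The binary tree of a Dyck word.

height-++ : ∀ u v → height (u ++ v) ≡ height u ℤ.+ height v
height-++ []      v = sym (ℤ.+-identityˡ (height v))
height-++ (b ∷ u) v = trans (cong (λ z → step b ℤ.+ z) (height-++ u v)) (sym (ℤ.+-assoc (step b) (height u) (height v)))

take-length-+ : ∀ {A : Set} (xs ys : List A) i → take (length xs + i) (xs ++ ys) ≡ xs ++ take i ys
take-length-+ []       ys i = refl
take-length-+ (x ∷ xs) ys i = cong (x ∷_) (take-length-+ xs ys i)

drop-length-+ : ∀ {A : Set} (xs ys : List A) i → drop (length xs + i) (xs ++ ys) ≡ drop i ys
drop-length-+ []       ys i = refl
drop-length-+ (x ∷ xs) ys i = drop-length-+ xs ys i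

take-++-≤ : ∀ {A : Set} i (xs ys : List A) → i ≤ length xs → take i (xs ++ ys) ≡ take i xs
take-++-≤ zero    xs       ys _        = refl
take-++-≤ (suc i) (x ∷ xs) ys (s≤s i≤) = cong (x ∷_) (take-++-≤ i xs ys i≤)

foldr-∷ʳ : ∀ {A : Set} (xs : List A) → foldr (λ x acc → acc ++ (x ∷ [])) [] xs ≡ reverse xs
foldr-∷ʳ []       = refl
foldr-∷ʳ (x ∷ xs) = trans (cong (_∷ʳ x) (foldr-∷ʳ xs)) (sym (List.unfold-reverse x xs))

-- The local zero test of lastZero has no name here; unification supplies it.
lastZero-search : ∀ w → Σ (ℕ → Bool) λ p →
  lastZero w ≡ foldr (λ j acc → if p j then j else acc) 0 (foldr (λ x acc → acc ++ (x ∷ [])) [] (upTo (length w)))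
lastZero-search w = _ , refl

-- The list descends, so the fold returns the largest index that passes the test.
search-downFrom : ∀ (p : ℕ → Bool) n m → m < n → p m ≡ true → (∀ j → m < j → j < n → p j ≡ false) →
  foldr (λ j acc → if p j then j else acc) 0 (downFrom n) ≡ m
search-downFrom p (suc n) m (s≤s m≤n) pm above with m ≟ n
... | yes refl rewrite pm = refl
... | no  m≢n rewrite above n (≤∧≢⇒< m≤n m≢n) ≤-refl =
  search-downFrom p n m (≤∧≢⇒< m≤n m≢n) pm (λ j m<j j<n → above j m<j (m≤n⇒m≤1+n j<n))

lastZero-≡ : ∀ w m → m < length w → height (take m w) ≡ + 0 →
  (∀ j → m < j → j < length w → ∃ λ k → height (take j w) ≡ + suc k) → lastZero w ≡ m
lastZero-≡ w m m< zero-m above = begin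
  lastZero w  ≡⟨ proj₂ (lastZero-search w) ⟩
  foldr search 0 (foldr (λ x acc → acc ++ (x ∷ [])) [] (upTo (length w)))
    ≡⟨ cong (foldr search 0) (trans (foldr-∷ʳ (upTo (length w))) (List.reverse-upTo (length w))) ⟩
  foldr search 0 (downFrom (length w))  ≡⟨ search-downFrom isZeroAt (length w) m m< (at-zero m zero-m) (λ j m<j j< → at-pos j (above j m<j j<)) ⟩
  m ∎
  where
  open ≡-Reasoning
  isZeroAt : ℕ → Bool
  isZeroAt = proj₁ (lastZero-search w)
  search : ℕ → ℕ → ℕ
  search j acc = if isZeroAt j then j else acc
  at-zero : ∀ j → height (take j w) ≡ + 0 → isZeroAt j ≡ true
  at-zero j eq rewrite eq = refl
  at-pos : ∀ j → (∃ λ k → height (take j w) ≡ + suc k) → isZeroAt j ≡ false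
  at-pos j (k , eq) rewrite eq = refl

treeF-unfold : ∀ f D → 0 < length D → treeF (suc f) D ≡
  node (treeF f (take (lastZero D) D)) (treeF f (take (length D ∸ lastZero D ∸ 2) (drop (suc (lastZero D)) D)))
treeF-unfold f (_ ∷ _) _ = refl

module _ (F G : Plane) where
  private
    u = word F
    v = word G
    w = u ++ true ∷ (v ∷ʳ false)

  length-last : length w ≡ length u + (2 + length v)
  length-last = trans (List.length-++ u) (cong (λ k → length u + suc k) (trans (List.length-++ v) (+-comm (length v) 1)))

  length-positive : 0 < length w
  length-positive = subst (0 <_) (sym (trans length-last (+-suc (length u) _))) (s≤s z≤n)

  -- The up-step after `u` keeps the path at height at least 1 until the final down-step, and the
  -- end point is not among the positions searched.
  lastZero-last : lastZero w ≡ length u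
  lastZero-last = lastZero-≡ w (length u)
    (subst (length u <_) (sym length-last) (m<m+n (length u) (s≤s z≤n)))
    (trans (cong height prefix) (height-word F))
    above
    where
    prefix : take (length u) w ≡ u
    prefix = trans (cong (λ k → take k w) (sym (+-identityʳ (length u))))
      (trans (take-length-+ u _ 0) (List.++-identityʳ u))

    above : ∀ j → length u < j → j < length w → ∃ λ k → height (take j w) ≡ + suc k
    above j u<j j<w with m≤n⇒∃[o]m+o≡n u<j
    ... | i , refl with height-prefix G i
    ...   | k , eq = k , (begin
      height (take (suc (length u) + i) w)             ≡⟨ cong (λ k → height (take k w)) (+-suc (length u) i) ⟨
      height (take (length u + suc i) w)               ≡⟨ cong height (take-length-+ u _ (suc i)) ⟩
      height (u ++ true ∷ take i (v ∷ʳ false))         ≡⟨ height-++ u _ ⟩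
      height u ℤ.+ (+ 1 ℤ.+ height (take i (v ∷ʳ false)))
        ≡⟨ cong₂ (λ a b → a ℤ.+ (+ 1 ℤ.+ height b)) (height-word F) (take-++-≤ i v _ i≤v) ⟩
      + 0 ℤ.+ (+ 1 ℤ.+ height (take i v))              ≡⟨ cong (λ z → + 0 ℤ.+ (+ 1 ℤ.+ z)) eq ⟩
      + suc k                                          ∎)
      where
      open ≡-Reasoning
      i≤v : i ≤ length v
      i≤v = ≤-pred (≤-pred (+-cancelˡ-≤ (length u) (suc (suc i)) _
        (subst₂ _≤_ (trans (cong suc (sym (+-suc (length u) i))) (sym (+-suc (length u) (suc i)))) length-last j<w)))

  treeF-last : ∀ f → treeF (suc f) w ≡ node (treeF f u) (treeF f v)
  treeF-last f = trans (treeF-unfold f w length-positive)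
    (cong₂ (λ a b → node (treeF f a) (treeF f b))
      (trans (cong (λ k → take k w) (trans lastZero-last (sym (+-identityʳ (length u)))))
             (trans (take-length-+ u _ 0) (List.++-identityʳ u)))
      (begin
        take (length w ∸ lastZero w ∸ 2) (drop (suc (lastZero w)) w)
          ≡⟨ cong₂ (λ a b → take (a ∸ b ∸ 2) (drop (suc b) w)) length-last lastZero-last ⟩
        take (length u + (2 + length v) ∸ length u ∸ 2) (drop (suc (length u)) w)
          ≡⟨ cong₂ (λ a b → take (a ∸ 2) (drop b w)) (m+n∸m≡n (length u) (2 + length v)) (+-comm 1 (length u)) ⟩
        take (length v) (drop (length u + 1) w)
          ≡⟨ cong (take (length v)) (drop-length-+ u _ 1) ⟩
        take (length v) (v ∷ʳ false)
          ≡⟨ trans (take-++-≤ (length v) v _ ≤-refl) (List.take-all (length v) v ≤-refl) ⟩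
        v ∎))
    where open ≡-Reasoning

word-toForest-node : ∀ l r → word (toForest (node l r)) ≡ word (toForest l) ++ true ∷ (word (toForest r) ∷ʳ false)
word-toForest-node l r = word-⊕ (toForest l) (toForest r ▸ ε)

-- The fuel is arbitrary because `treeF` hands the same amount to both parts, which is more than
-- their lengths require.
treeF-word : ∀ t f → length (word (toForest t)) ≤ f → treeF f (word (toForest t)) ≡ t
treeF-word leaf zero    _ = refl
treeF-word leaf (suc f) _ = refl
treeF-word (node l r) f len≤f rewrite word-toForest-node l r | length-last (toForest l) (toForest r) = unfold f len≤f
  where
  u = word (toForest l)
  v = word (toForest r)
  unfold : ∀ f → length u + (2 + length v) ≤ f → treeF f (u ++ true ∷ (v ∷ʳ false)) ≡ node l r
  unfold zero    p = contradiction (≤-trans (≤-reflexive (sym (+-suc (length u) _))) p) λ ()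
  unfold (suc f) p = trans (treeF-last (toForest l) (toForest r) f)
    (cong₂ node (treeF-word l f (≤-trans (m≤m+n _ _) q)) (treeF-word r f (≤-trans (m≤n+m _ _) (≤-trans (+-monoʳ-≤ (length u) (n≤1+n _)) q))))
    where
    q : length u + suc (length v) ≤ f
    q = ≤-pred (≤-trans (≤-reflexive (sym (+-suc (length u) _))) p)

tree-word : ∀ F → tree (word F) ≡ toTree F
tree-word F = subst (λ G → tree (word G) ≡ toTree F) (toForest-toTree F) (treeF-word (toTree F) _ ≤-refl)

-- The bijection between intervals of Dyck paths.

parse : List Bool → Plane
parse w = toForest (tree w)

parse-word : ∀ F → parse (word F) ≡ F
parse-word F = trans (cong toForest (tree-word F)) (toForest-toTree F)

Words : Set
Words = List Bool × List Bool

words : Pair → Words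
words (F , G) = word F , word G

-- Defined on arbitrary words: the proofs in `Coef` are irrelevant, so the new words may not be
-- computed from them.
exchange : Words → Words
exchange (D₁ , D₂) = words (riseContact (parse D₁ , parse D₂))

-- Coef with its proof fields made relevant, so that they can be matched on.
record IsCoef (n a b : ℕ) (M N : List ℕ) (d : ℕ) (D : Words) : Set where
  constructor isCoef
  field
    lowerDyck  : IsDyck n (proj₁ D)
    upperDyck  : IsDyck n (proj₂ D)
    interval   : proj₁ D ≤D proj₂ D
    contactsEq : contacts (proj₁ D) ≡ a
    risesEq    : rises (proj₂ D) ≡ b
    cmonEq     : contactMon n (proj₁ D) ↭ M
    rmonEq     : riseMon n (proj₂ D) ↭ N
    distEq     : Dist (proj₁ D) (proj₂ D) d

Chain⇒≤T : ∀ {s t k} → Chain s t k → s ≤T t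
Chain⇒≤T []            = done
Chain⇒≤T ((p , _) ∷ c) = p ◅◅ Chain⇒≤T c

-- Contacts of the new lower path and rises of the old upper one are both read off a forest with the
-- code of `reread G`, up to order; likewise with the roles exchanged.
exchange-IsCoef : ∀ {n a b M N d} D → IsCoef n a b M N d D →
  IsCoef n b a N M d (exchange D) × exchange (exchange D) ≡ D
exchange-IsCoef {n} {M = M} {N} {d} (D₁ , D₂) (isCoef D₁-Dyck D₂-Dyck _ refl refl cmon rmon dist)
  with IsDyck⇒word {n} D₁-Dyck | IsDyck⇒word {n} D₂-Dyck
... | F , refl , refl | G , sizeG , refl rewrite parse-word F | parse-word G =
    isCoef (word-IsDyck F′ size-F′) (word-IsDyck G′ E.upper-size) (Chain⇒≤T (proj₁ dist′))
      (trans (contacts-word F′) (trans E.lower-len (sym (rises-word G))))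
      (trans (rises-word G′) (trans E.upper-len (sym (contacts-word F))))
      (↭-trans (subst (λ m → contactMon m (word F′) ↭ riseMon m (word G)) size-F′
        (↭-trans (↭-reflexive (contactMon-word F′)) (↭-trans (monomial-↭ E.lower-len E.lower-code)
          (↭-reflexive (trans (cong (λ m → monomial m (reread G)) size-F′G)
            (trans (sym (riseMon-word G)) (cong (λ m → riseMon m (word G)) (sym size-F′G)))))))) rmon)
      (↭-trans (subst (λ m → riseMon m (word G′) ↭ contactMon (size F) (word F)) E.upper-size
        (↭-trans (↭-reflexive (trans (riseMon-word G′) (cong (λ m → monomial m (reread G′)) (sym (size-reread G′)))))
          (↭-trans (monomial-↭ E.upper-len E.upper-code)
            (↭-reflexive (trans (cong (λ m → monomial m F) (trans (size-reread G′) E.upper-size)) (sym (contactMon-word F))))))) cmon)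
      dist′
  , cong words (trans (cong₂ (λ A B → riseContact (A , B)) (parse-word F′) (parse-word G′)) E.involutive)
  where
  F≼G : F ≼ G [ d ]
  F≼G = DistT⇒≼ (subst₂ (λ s t → DistT s t d) (tree-word F) (tree-word G) dist)
  module E = Exchanged (riseContact-≼ (F , G) d F≼G)
  F′ = proj₁ (riseContact (F , G))
  G′ = proj₂ (riseContact (F , G))
  dist′ : Dist (word F′) (word G′) d
  dist′ = subst₂ (λ s t → DistT s t d) (sym (tree-word F′)) (sym (tree-word G′)) (≼⇒DistT E.isInterval)
  size-F′G : size F′ ≡ size G
  size-F′G = trans (sym (length-code F′)) (trans (Perm.↭-length E.lower-code) (trans (length-code (reread G)) (size-reread G)))
  size-F′ : size F′ ≡ size F
  size-F′ = trans size-F′G sizeG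

module _ {n a b d : ℕ} {M N : List ℕ} where
  toCoef : (D : Words) → .(IsCoef n a b M N d D) → Coef n a b M N d
  toCoef D p = record
    { lower = proj₁ D ; upper = proj₂ D
    ; lowerDyck = IsCoef.lowerDyck p ; upperDyck = IsCoef.upperDyck p ; interval = IsCoef.interval p
    ; contactsEq = IsCoef.contactsEq p ; risesEq = IsCoef.risesEq p
    ; cmonEq = IsCoef.cmonEq p ; rmonEq = IsCoef.rmonEq p ; distEq = IsCoef.distEq p }

  toCoef-cong : ∀ {D E} .(p : IsCoef n a b M N d D) .(q : IsCoef n a b M N d E) → D ≡ E → toCoef D p ≡ toCoef E q
  toCoef-cong p q refl = refl

exchangeCoef : ∀ {n a b d M N} → Coef n a b M N d → Coef n b a N M d
exchangeCoef record { lower = D₁ ; upper = D₂ ; lowerDyck = p₁ ; upperDyck = p₂ ; interval = p₃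
  ; contactsEq = p₄ ; risesEq = p₅ ; cmonEq = p₆ ; rmonEq = p₇ ; distEq = p₈ } =
  toCoef (exchange (D₁ , D₂)) (proj₁ (exchange-IsCoef (D₁ , D₂) (isCoef p₁ p₂ p₃ p₄ p₅ p₆ p₇ p₈)))

exchangeCoef-involutive : ∀ {n a b d M N} (x : Coef n a b M N d) → exchangeCoef (exchangeCoef x) ≡ x
exchangeCoef-involutive {n} record { lower = D₁ ; upper = D₂ ; lowerDyck = p₁ ; upperDyck = p₂ ; interval = p₃
  ; contactsEq = p₄ ; risesEq = p₅ ; cmonEq = p₆ ; rmonEq = p₇ ; distEq = p₈ } =
  toCoef-cong {n}
    (proj₁ (exchange-IsCoef {n} (exchange (D₁ , D₂))
      (proj₁ (exchange-IsCoef {n} (D₁ , D₂) (isCoef p₁ p₂ p₃ p₄ p₅ p₆ p₇ p₈)))))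
    (isCoef p₁ p₂ p₃ p₄ p₅ p₆ p₇ p₈)
    -- The equality of words is available only irrelevantly; decidability of equality makes it
    -- usable.
    (recompute (Product.≡-dec (List.≡-dec Bool._≟_) (List.≡-dec Bool._≟_) _ _)
      (proj₂ (exchange-IsCoef {n} (D₁ , D₂) (isCoef p₁ p₂ p₃ p₄ p₅ p₆ p₇ p₈))))

theorem3p4 : (n a b d : ℕ) (M N : List ℕ) →
    Coef n a b M N d ↔ Coef n b a N M d
theorem3p4 n a b d M N = mk↔ₛ′ exchangeCoef exchangeCoef exchangeCoef-involutive exchangeCoef-involutive
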